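{- Let $x>2$ and $y$ be integers with $y>(2x^2+2x+1)/(x-2)$. Then there exists $V$ such that for every integer $v\ge V$ with $v\equiv\pm1\pmod{xy}$, every multiset of size $v-1$ with support $\{1,x,y\}$ is realizable.
   Context: $K_v$ is the complete graph on vertex set $\{0,\dots,v-1\}$; the length of an edge $\{u,w\}$ is $\min(|u-w|,v-|u-w|)$. A multiset $L$ of size $v-1$ is realizable if some Hamiltonian path in $K_v$ has multiset of edge lengths equal to $L$. The support of a multiset is its set of distinct elements. (The paper phrases this as the Buratti–Horak–Rosa Conjecture holding for such $L$; for $v\equiv\pm1\pmod{xy}$ its divisibility condition is vacuous.) -}

module Defs where

open import Data.Nat using (ℕ; zero; suc; _+_; _*_; _∸_; _⊓_; ∣_-_∣)
open import Data.List using (List; []; _∷_; length; upTo)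
open import Data.List.Membership.Propositional using (_∈_)
open import Data.List.Relation.Unary.All using (All)
open import Data.List.Relation.Binary.Permutation.Propositional using (_↭_)
open import Data.Product using (Σ; _×_; ∃)
open import Data.Sum using (_⊎_)
open import Relation.Binary.PropositionalEquality using (_≡_)

edgeLength : ℕ → ℕ → ℕ → ℕ
edgeLength v u w = ∣ u - w ∣ ⊓ (v ∸ ∣ u - w ∣)

pathLengths : ℕ → List ℕ → List ℕ
pathLengths v []            = []
pathLengths v (u ∷ [])      = []
pathLengths v (u ∷ w ∷ ws)  = edgeLength v u w ∷ pathLengths v (w ∷ ws)

-- a Hamiltonian path of K_v: an ordering of all vertices 0..v-1, each exactly once
IsHamiltonianPath : ℕ → List ℕ → Set
IsHamiltonianPath v p = p ↭ upTo v

-- a multiset (represented as a list, up to permutation) is realizable in K_v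
Realizable : ℕ → List ℕ → Set
Realizable v L = Σ (List ℕ) λ p → IsHamiltonianPath v p × (pathLengths v p ↭ L)

HasSupport3 : List ℕ → ℕ → ℕ → ℕ → Set
HasSupport3 L a b c =
  All (λ z → z ≡ a ⊎ z ≡ b ⊎ z ≡ c) L × (a ∈ L) × (b ∈ L) × (c ∈ L)

PlusMinusOneMod : ℕ → ℕ → Set
PlusMinusOneMod v m = (∃ λ k → v ≡ k * m + 1) ⊎ (∃ λ k → v + 1 ≡ k * m)

{-# OPTIONS --safe #-}
-- Multiplying the vertices of a Hamiltonian path by a unit c mod v replaces each
-- length d by the length of c d, so it is enough to realize {1^α, X^β, Y^γ} with
-- α ≥ X + Y, for steps 1, X, Y whose multiples by c are the prescribed lengths up
-- to sign.  For this, a path from 0 on {0, …, n} with steps 1 and Y is joined at 0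
-- to the reflection of a path from 0 on {0, …, m} with steps 1 and X; each zigzags
-- through the residue classes of its long step X (or Y) and spends at most X (or
-- Y) unit steps.  Let v = k x y ± 1 and let a, b, c be the multiplicities of 1, x,
-- y.  Take the unit 1 if a ≥ x + y, the unit y with X = k x and Y = k x² if
-- c ≥ k x + k x², and otherwise the unit x with X = k y and Y ≤ v / 2 such that
-- x Y ≡ ± y; then b ≥ X + Y follows from the bound on y as soon as k ≥ x + y.
module Submission where

open import Defs
open import Data.Bool using (Bool; true; false; not)
open import Data.Integer as ℤ using (ℤ; +_; -[1+_])
open import Data.Integer.DivMod using (_%ℕ_; _/ℕ_; n%ℕd<d; a≡a%ℕn+[a/ℕn]*n)
import Data.Integer.Properties as ℤ
import Data.Integer.Tactic.RingSolver as ℤ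
open import Data.List using (List; []; _∷_; _++_; _ʳ++_; length; map; upTo; replicate)
open import Data.List.Membership.Propositional using (_∈_)
open import Data.List.Membership.Propositional.Properties
  using (∈-map⁺; ∈-∃++; ∈-++⁺ˡ; ∈-++⁺ʳ; ∈-upTo⁻)
open import Data.List.Properties
  using (++-assoc; length-++; length-map; length-upTo; length-ʳ++; length-replicate)
open import Data.List.Relation.Binary.Permutation.Propositional hiding (trans)
open import Data.List.Relation.Binary.Permutation.Propositional.Properties
  using (shift; shifts; ↭-length; ∈-resp-↭; ++⁺; ++⁺ˡ; ++-comm)
open import Data.List.Relation.Unary.All as All using (All)
import Data.List.Relation.Unary.AllPairs as AllPairs
open import Data.List.Relation.Unary.Any using (here; there)
open import Data.List.Relation.Unary.Any.Properties using (reverseAcc⁺)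
open import Data.List.Relation.Unary.Unique.Propositional using (Unique)
open import Data.List.Relation.Unary.Unique.Propositional.Properties using (upTo⁺)
open import Data.Nat
open import Data.Nat.DivMod using (m≡m%n+[m/n]*n; m%n<n; m<n*o⇒m/o<n)
open import Data.Nat.Properties
open import Data.Nat.Tactic.RingSolver using (solve; solve-∀)
open import Data.Product using (Σ; ∃; ∃₂; _×_; _,_)
open import Data.Sum as Sum using (_⊎_; inj₁; inj₂; [_,_]′)
open import Function using (_∘_; id)
open import Relation.Binary.PropositionalEquality
open import Relation.Nullary using (¬_; contradiction)
open import Relation.Unary using (_⊆_; _∪_)

-- Walks with steps of length 1 and `x`, and tours that record the vertices met.

Apart : ℕ → ℕ → ℕ → Set
Apart d u w = w ≡ u + d ⊎ u ≡ w + d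

-- The list holds the vertices after the first one; the last two indices count
-- the unit steps and the steps of length x.
data Walk (x : ℕ) : ℕ → ℕ → List ℕ → ℕ → ℕ → Set where
  stop : ∀ {u} → Walk x u u [] 0 0
  unit : ∀ {u w z p a b} → Apart 1 u w → Walk x w z p a b → Walk x u z (w ∷ p) (suc a) b
  jump : ∀ {u w z p a b} → Apart x u w → Walk x w z p a b → Walk x u z (w ∷ p) a (suc b)

module _ {x : ℕ} where

  infixr 5 _⋯_

  _⋯_ : ∀ {u w z p q a b a′ b′} → Walk x u w p a b → Walk x w z q a′ b′ →
        Walk x u z (p ++ q) (a + a′) (b + b′)
  stop     ⋯ q = q
  unit e p ⋯ q = unit e (p ⋯ q)
  jump e p ⋯ q = jump e (p ⋯ q)

  walk-length : ∀ {u w p a b} → Walk x u w p a b → length p ≡ a + b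
  walk-length stop = refl
  walk-length (unit _ p) = cong suc (walk-length p)
  walk-length {a = a} {suc b} (jump _ p) = trans (cong suc (walk-length p)) (sym (+-suc a b))

  Apart-translate : ∀ t {d u w} → Apart d u w → Apart d (t + u) (t + w)
  Apart-translate t {d} (inj₁ refl) = inj₁ (sym (+-assoc t _ d))
  Apart-translate t {d} (inj₂ refl) = inj₂ (sym (+-assoc t _ d))

  translate : ∀ t {u w p a b} → Walk x u w p a b → Walk x (t + u) (t + w) (map (_+_ t) p) a b
  translate t stop = stop
  translate t (unit e p) = unit (Apart-translate t e) (translate t p)
  translate t (jump e p) = jump (Apart-translate t e) (translate t p)

-- Coverage is only an inclusion. That no vertex is met twice follows by counting steps once two
-- tours have been joined.
record Tour (x u w a b : ℕ) (S : ℕ → Set) : Set where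
  constructor tour
  field
    {tail} : List ℕ
    walk   : Walk x u w tail a b
    covers : ∀ {n} → S n → n ∈ u ∷ tail

open Tour public

-- Tours of blocks of columns modulo `x`.

module _ {x : ℕ} where

  stay : ∀ {u} → Tour x u u 0 0 (_≡ u)
  stay = tour stop here

  infixr 5 _⟨_⟩_

  _⟨_⟩_ : ∀ {u w w′ z a b a′ b′ S S′} → Tour x u w a b S → Apart 1 w w′ →
          Tour x w′ z a′ b′ S′ → Tour x u z (a + suc a′) (b + b′) (S ∪ S′)
  p ⟨ e ⟩ q = tour (walk p ⋯ unit e (walk q))
    [ ∈-++⁺ˡ ∘ covers p , ∈-++⁺ʳ (_ ∷ tail p) ∘ covers q ]′

  restrict : ∀ {u w a b a′ b′ S S′} → Tour x u w a b S → a ≡ a′ → b ≡ b′ → S′ ⊆ S →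
             Tour x u w a′ b′ S′
  restrict p refl refl S′⊆S = tour (walk p) (covers p ∘ S′⊆S)

  -- A boolean names an end of a column, `true` the top; traversing a whole column acts on it as
  -- `not`.
  level : Bool → ℕ → ℕ
  level false h = 0
  level true  h = h

  -- Heights and widths count steps, not vertices: Column i h has h + 1 vertices
  -- and Block i w h consists of the w + 1 columns from i to i + w.
  Column : ℕ → ℕ → ℕ → Set
  Column i h n = ∃ λ l → l ≤ h × n ≡ i + l * x

  ascend : ∀ h {u w} → w ≡ u + h * x → Tour x u w 0 h (Column u h)
  ascend zero {u} w≡ rewrite trans w≡ (+-identityʳ u) =
    tour stop λ { (zero , _ , refl) → here (+-identityʳ u) }
  ascend (suc h) {u} w≡ = tour (jump (inj₁ refl) (walk rest)) λ where
      (zero  , _     , refl) → here (+-identityʳ u)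
      (suc l , s≤s p , refl) → there (covers rest (l , p , sym (+-assoc u x (l * x))))
    where rest = ascend h (trans w≡ (sym (+-assoc u x (h * x))))

  descend : ∀ i h → Tour x (i + h * x) (i + 0) 0 h (Column i h)
  descend i zero = tour stop λ { (zero , _ , refl) → here refl }
  descend i (suc h) = tour (jump (inj₂ step) (walk rest)) cover
    where
    step : i + suc h * x ≡ i + h * x + x
    step = solve (i ∷ h ∷ x ∷ [])
    rest = descend i h
    cover : ∀ {n} → Column i (suc h) n → n ∈ (i + suc h * x) ∷ (i + h * x) ∷ tail rest
    cover (l , l≤1+h , refl) with m≤n⇒m<n∨m≡n l≤1+h
    ... | inj₁ (s≤s l≤h) = there (covers rest (l , l≤h , refl))
    ... | inj₂ refl      = here refl

  column : ∀ i h s → Tour x (i + level s h * x) (i + level (not s) h * x) 0 h (Column i h)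
  column i h true  = descend i h
  column i h false rewrite +-identityʳ i = ascend h refl

  Block : ℕ → ℕ → ℕ → ℕ → Set
  Block i w h n = ∃₂ λ j l → j ≤ w × l ≤ h × n ≡ i + j + l * x

  -- The end at which a zigzag through `w + 1` columns leaves when it enters at `s`; only the parity
  -- of `w` matters.
  flips : ℕ → Bool → Bool
  flips zero    s = not s
  flips (suc w) s = flips w (not s)

  Block-suc : ∀ i w h → Block i (suc w) h ⊆ Column (i + suc w) h ∪ Block i w h
  Block-suc i w h (j , l , j≤1+w , l≤h , n≡) with m≤n⇒m<n∨m≡n j≤1+w
  ... | inj₁ (s≤s j≤w) = inj₂ (j , l , j≤w , l≤h , n≡)
  ... | inj₂ refl      = inj₁ (l , l≤h , n≡)

  left : ∀ i j k → Apart 1 (i + suc j + k) (i + j + k)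
  left i j k = inj₂ eq
    where
    eq : i + suc j + k ≡ i + j + k + 1
    eq = solve (i ∷ j ∷ k ∷ [])

  -- Columns are traversed from right to left, alternately up and down, and a unit step at constant
  -- height joins neighbours. The exit is kept explicit because another tour is attached there.
  zigzag : ∀ i w h s →
    Tour x (i + w + level s h * x) (i + level (flips w s) h * x) w (suc w * h) (Block i w h)
  zigzag i zero h s rewrite +-identityʳ i =
    restrict (column i h s) refl (sym (+-identityʳ h))
      λ { (zero , l , _ , l≤h , refl) → l , l≤h , cong (_+ l * x) (+-identityʳ i) }
  zigzag i (suc w) h s = restrict
    (column (i + suc w) h s ⟨ left i w _ ⟩ zigzag i w h (not s))
    refl refl (Block-suc i w h)

  -- The last two columns are left by the end at which they were entered, which
  -- trades one step of length x for a unit step.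
  loop : ∀ i h s → Σ ℕ λ z →
    Tour x (i + 1 + level s (suc h) * x) z 2 (suc h + h) (Block i 1 (suc h))
  loop i h true = _ , restrict
    (stay ⟨ left i 0 _ ⟩ column (i + 0) (suc h) true
      ⟨ inj₁ right ⟩ ascend h {i + 1} refl)
    refl refl λ where
      (zero , l , _ , l≤ , refl) → inj₂ (inj₁ (l , l≤ , refl))
      (suc zero , l , _ , l≤ , refl) → top l l≤
      (suc (suc _) , _ , s≤s () , _)
    where
    right : i + 1 ≡ i + 0 + 0 + 1
    right = solve (i ∷ [])
    top : ∀ l → l ≤ suc h →
      ((_≡ i + 1 + suc h * x) ∪ Column (i + 0) (suc h) ∪ Column (i + 1) h) (i + 1 + l * x)
    top l l≤ with m≤n⇒m<n∨m≡n l≤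
    ... | inj₁ (s≤s l≤h) = inj₂ (inj₂ (l , l≤h , refl))
    ... | inj₂ refl      = inj₁ refl
  loop i h false = _ , restrict
    (stay ⟨ left i 0 _ ⟩ column (i + 0) (suc h) false
      ⟨ inj₁ right ⟩ descend (i + 1 + x) h)
    refl refl λ where
      (zero , l , _ , l≤ , refl) → inj₂ (inj₁ (l , l≤ , refl))
      (suc zero , zero , _ , _ , refl) → inj₁ refl
      (suc zero , suc l , _ , s≤s l≤ , refl) →
        inj₂ (inj₂ (l , l≤ , sym (+-assoc (i + 1) x (l * x))))
      (suc (suc _) , _ , s≤s () , _)
    where
    right : i + 1 + x + h * x ≡ i + 0 + suc h * x + 1
    right = solve (i ∷ h ∷ x ∷ [])

  -- With `loop` on the last two columns, the block costs one unit step more and one long step fewer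
  -- than with `zigzag`. Nothing is attached to the end, so it stays existential.
  zigzag-loop : ∀ i w h s → Σ ℕ λ z →
    Tour x (i + suc w + level s (suc h) * x) z (2 + w) (suc w * suc h + h) (Block i (suc w) (suc h))
  zigzag-loop i zero h s with z , p ← loop i h s = z ,
    restrict p refl (cong (λ k → suc k + h) (sym (+-identityʳ h))) id
  zigzag-loop i (suc w) h s with z , p ← zigzag-loop i w h (not s) = z , restrict
    (column (i + suc (suc w)) (suc h) s ⟨ left i (suc w) _ ⟩ p)
    refl (sym (+-assoc (suc h) _ h)) (Block-suc i (suc w) (suc h))

  zigzag-right : ∀ i w h s → ∃ λ z → Tour x (i + level s h * x) z w (suc w * h) (Block i w h)
  zigzag-right i zero h s = _ , restrict (column i h s) refl (sym (+-identityʳ h))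
    λ { (zero , l , _ , l≤h , refl) → l , l≤h , cong (_+ l * x) (+-identityʳ i) }
  zigzag-right i (suc w) h s with z , p ← zigzag-right (suc i) w h (not s) = z , restrict
    (column i h s ⟨ inj₁ (sym (+-comm _ 1)) ⟩ p) refl refl λ where
      (zero  , l , _       , l≤h , refl) → inj₁ (l , l≤h , cong (_+ l * x) (+-identityʳ i))
      (suc j , l , s≤s j≤w , l≤h , refl) → inj₂ (j , l , j≤w , l≤h , cong (_+ l * x) (+-suc i j))

  -- An odd number of columns is left at the end opposite to the entry; entered at the top, it is
  -- left at the bottom, where long and short columns are level.
  flips-even : ∀ m s → flips (m * 2) s ≡ not s
  flips-even zero    s     = refl
  flips-even (suc m) true  = flips-even m true
  flips-even (suc m) false = flips-even m false

  -- Column 0 is entered at the bottom; from its top the unit step down leads to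
  -- the top of the last column.
  front : ∀ s d h → x ≡ suc (s + d) →
    Tour x 0 (s + level (flips d true) h * x) (suc d) (suc h + suc d * h)
      (Column 0 (suc h) ∪ Block s d h)
  front s d h refl = ascend (suc h) refl ⟨ inj₂ (sym (+-comm _ 1)) ⟩ zigzag s d h true

  -- Columns `1` to `s - 1`. Unlike a `Block`, this can be empty, as it is for `s = 1`.
  Strip : ℕ → ℕ → ℕ → Set
  Strip s h n = ∃₂ λ j l → suc j < s × l ≤ h × n ≡ suc (j + l * x)

  module _ .{{_ : NonZero x}} where

    -- Division by `x`: below `s + (h + 1) x` the quotient is at most `h + 1`, and at most `h` when
    -- the remainder is `s` or more.
    locate : ∀ s d h {n} → x ≡ suc (s + d) → n < s + suc h * x →
             (Column 0 (suc h) ∪ Block s d h ∪ Strip s (suc h)) n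
    locate s d h {n} x≡ n< = split (n % x) refl (≤-<-connex s (n % x))
      where
      l = n / x
      s≤x : s ≤ x
      s≤x = ≤-trans (m≤m+n s d) (≤-trans (n≤1+n _) (≤-reflexive (sym x≡)))
      l≤1+h : l ≤ suc h
      l≤1+h = s≤s⁻¹ (m<n*o⇒m/o<n (<-≤-trans n< (+-monoˡ-≤ (suc h * x) s≤x)))
      n≡ : ∀ {j} → n % x ≡ j → n ≡ j + l * x
      n≡ j≡ = trans (m≡m%n+[m/n]*n n x) (cong (_+ l * x) j≡)
      split : ∀ j → n % x ≡ j → s ≤ j ⊎ j < s →
              (Column 0 (suc h) ∪ Block s d h ∪ Strip s (suc h)) n
      split zero    j≡ (inj₂ _)   = inj₁ (l , l≤1+h , n≡ j≡)
      split (suc j) j≡ (inj₂ j<s) = inj₂ (inj₂ (j , l , j<s , l≤1+h , n≡ j≡))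
      split j       j≡ (inj₁ s≤j) = inj₂ (inj₁ (j ∸ s , l , j∸s≤d , l≤h ,
          trans (n≡ j≡) (cong (_+ l * x) (sym (m+[n∸m]≡n s≤j)))))
        where
        j∸s≤d : j ∸ s ≤ d
        j∸s≤d = ≤-trans (∸-monoˡ-≤ s (s≤s⁻¹ (subst₂ _<_ j≡ x≡ (m%n<n n x))))
                        (≤-reflexive (m+n∸m≡n s d))
        l≤h : l ≤ h
        l≤h = s≤s⁻¹ (*-cancelʳ-< x l (suc h) (+-cancelˡ-< s _ _
          (≤-<-trans (+-monoˡ-≤ (l * x) s≤j) (subst (_< s + suc h * x) (n≡ j≡) n<))))

-- Hamiltonian paths of initial segments with a prescribed number of long steps.

even⊎odd : ∀ n → ∃ λ m → n ≡ m * 2 ⊎ n ≡ suc (m * 2)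
even⊎odd zero = 0 , inj₁ refl
even⊎odd (suc n) with even⊎odd n
... | m , inj₁ n≡ = m , inj₂ (cong suc n≡)
... | m , inj₂ n≡ = suc m , inj₁ (cong suc n≡)

-- A walk of `a + b` steps lists `a + b + 1` vertices, so covering all `n ≤ a + b` makes it a
-- Hamiltonian path of that segment.
Sweep : ℕ → ℕ → Set
Sweep x b = ∃ λ a → a ≤ x × ∃ λ z → Tour x 0 z a b (_≤ a + b)

sweep-level : ∀ w h → Sweep (suc w) (h * suc w)
sweep-level w h with z , p ← zigzag-right 0 w h false =
  w , n≤1+n w , z , restrict p refl (*-comm (suc w) h)
    λ {n} n≤ → n % suc w , n / suc w , s≤s⁻¹ (m%n<n n (suc w)) ,
      s≤s⁻¹ (m<n*o⇒m/o<n {n} {suc h} (s≤s n≤)) , m≡m%n+[m/n]*n n (suc w)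

-- Only column 0 is long, and `front` already ends the tour.
sweep-one : ∀ d h → Sweep (suc (suc d)) (1 + h * suc (suc d))
sweep-one d h = suc d , n≤1+n _ , _ , restrict (front 1 d h refl) refl count
  λ n≤ → Sum.map₂ [ id , (λ { (_ , _ , s≤s () , _) }) ]′
    (locate 1 d h refl (≤-trans (s≤s n≤) (≤-reflexive bound)))
  where
  count : suc h + suc d * h ≡ 1 + h * suc (suc d)
  count = solve (d ∷ h ∷ [])
  bound : suc (suc d + (1 + h * suc (suc d))) ≡ 1 + suc h * suc (suc d)
  bound = solve (d ∷ h ∷ [])

-- After column 0 and the `2 m + 1` short columns, the tour is at the bottom of column `s` and
-- continues through the long columns `s - 1` to `1`.
sweep-odd : ∀ t m h → let s = suc (suc t); x = suc (s + m * 2) in Sweep x (s + h * x)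
sweep-odd t m h with p ← front (suc (suc t)) (m * 2) h refl
  rewrite flips-even {suc (suc (suc t) + m * 2)} m true =
  _ , a≤x , _ , restrict (p ⟨ inj₂ step ⟩ zigzag 1 t (suc h) false) refl count
    λ n≤ → Sum.assocˡ (Sum.map₂ (Sum.map₂
      λ { (j , l , s≤s (s≤s j≤t) , l≤ , n≡) → j , l , j≤t , l≤ , n≡ })
      (locate (suc (suc t)) (m * 2) h refl (≤-trans (s≤s n≤) (≤-reflexive bound))))
  where
  step : suc (suc t) + 0 ≡ 1 + t + 0 + 1
  step = solve (t ∷ [])
  a≤x : suc (m * 2) + suc t ≤ suc (suc (suc t) + m * 2)
  a≤x = ≤-trans (n≤1+n _) (≤-reflexive eq)
    where
    eq : suc (suc (m * 2) + suc t) ≡ suc (suc (suc t) + m * 2)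
    eq = solve (t ∷ m ∷ [])
  count : (suc h + suc (m * 2) * h) + suc t * suc h ≡ suc (suc t) + h * suc (suc (suc t) + m * 2)
  count = solve (t ∷ m ∷ h ∷ [])
  bound : suc (suc (m * 2) + suc t + (suc (suc t) + h * suc (suc (suc t) + m * 2))) ≡
          suc (suc t) + suc h * suc (suc (suc t) + m * 2)
  bound = solve (t ∷ m ∷ h ∷ [])

-- Column `s` is made long, which leaves `2 m + 1` short ones; `zigzag-loop` gives the surplus long
-- step back. This is the only case that takes `x` unit steps instead of `x - 1`.
sweep-even : ∀ t m h → let s = suc (suc t); x = suc (suc s + m * 2) in Sweep x (s + h * x)
sweep-even t m h
  with p ← front (suc (suc (suc t))) (m * 2) h refl
     | z , q ← zigzag-loop {suc (suc (suc (suc t)) + m * 2)} 1 t h false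
  rewrite flips-even {suc (suc (suc (suc t)) + m * 2)} m true =
  _ , ≤-reflexive a≡x , _ , restrict (p ⟨ inj₂ step ⟩ q) refl count
    λ n≤ → Sum.assocˡ (Sum.map₂ (Sum.map₂
      λ { (j , l , s≤s (s≤s j≤t) , l≤ , n≡) → j , l , j≤t , l≤ , n≡ })
      (locate (suc (suc (suc t))) (m * 2) h refl (≤-trans (s≤s n≤) (≤-reflexive bound))))
  where
  step : suc (suc (suc t)) + 0 ≡ 1 + suc t + 0 + 1
  step = solve (t ∷ [])
  a≡x : suc (m * 2) + suc (2 + t) ≡ suc (suc (suc (suc t)) + m * 2)
  a≡x = solve (t ∷ m ∷ [])
  count : (suc h + suc (m * 2) * h) + (suc t * suc h + h) ≡
          suc (suc t) + h * suc (suc (suc (suc t)) + m * 2)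
  count = solve (t ∷ m ∷ h ∷ [])
  bound : suc (suc (m * 2) + suc (2 + t) + (suc (suc t) + h * suc (suc (suc (suc t)) + m * 2))) ≡
          suc (suc (suc t)) + suc h * suc (suc (suc (suc t)) + m * 2)
  bound = solve (t ∷ m ∷ h ∷ [])

-- For b = s + h x the columns below s have h + 2 vertices and the others h + 1.
-- If s ≥ 2, the zigzag must pass from the short columns to the long ones at the
-- bottom, so their number x ∸ s has to be odd; if it is even, one short column is
-- made long and the extra step of length x is traded away by loop.
sweep : ∀ x b .{{_ : NonZero x}} → Sweep x b
sweep x b with b % x | b / x | m≡m%n+[m/n]*n b x | m%n<n b x
sweep (suc w) b | zero  | h | refl | _ = sweep-level w h
sweep x       b | suc s | h | refl | s<x with m≤n⇒∃[o]m+o≡n s<x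
sweep x b | suc zero    | h | refl | s<x | d , refl = sweep-one d h
sweep x b | suc (suc t) | h | refl | s<x | d , refl with even⊎odd d
... | m , inj₁ refl = sweep-odd t m h
... | m , inj₂ refl = subst (λ x → Sweep x (suc (suc t) + h * x))
  (sym (cong (suc ∘ suc ∘ suc) (+-suc t (m * 2)))) (sweep-even t m h)

-- Unit steps beyond those of `sweep` are spent at the start, each on one new vertex below the
-- shifted tour.
pad : ∀ {x z a b} → Tour x 0 z a b (_≤ a + b) → Tour x 0 (suc z) (suc a) b (_≤ suc a + b)
pad p = tour (unit (inj₁ refl) (translate 1 (walk p)))
  λ { {zero} _ → here refl ; {suc n} (s≤s n≤) → there (∈-map⁺ suc (covers p n≤)) }

initial-tour : ∀ x a b .{{_ : NonZero x}} → x ≤ a → ∃ λ z → Tour x 0 z a b (_≤ a + b)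
initial-tour x a b x≤a with a₀ , a₀≤x , z , p ← sweep x b
                       with k , a₀+k≡a ← m≤n⇒∃[o]m+o≡n (≤-trans a₀≤x x≤a) =
  k + z , subst (λ a → Tour x 0 (k + z) a b (_≤ a + b)) (trans (+-comm k a₀) a₀+k≡a) (pads k)
  where
  pads : ∀ k → Tour x 0 (k + z) (k + a₀) b (_≤ k + a₀ + b)
  pads zero    = p
  pads (suc k) = pad (pads k)

-- Permutations by counting, and lengths along two joined paths.

unique-⊆⇒↭ : {A : Set} {xs ys : List A} → Unique xs → (∀ {z} → z ∈ xs → z ∈ ys) →
             length ys ≤ length xs → ys ↭ xs
unique-⊆⇒↭ {ys = []}     AllPairs.[] ⊆ys ≤xs = ↭-refl
unique-⊆⇒↭ {xs = x ∷ xs} (x∉xs AllPairs.∷ xs!) ⊆ys ≤xs with ps , qs , refl ← ∈-∃++ (⊆ys (here refl)) =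
  ↭-trans (shift x ps qs) (prep x (unique-⊆⇒↭ xs! ⊆rest
    (s≤s⁻¹ (≤-trans (≤-reflexive (sym (↭-length (shift x ps qs)))) ≤xs))))
  where
  -- Deleting one occurrence of `x` loses nothing that `xs` needs, since `x` does not recur in `xs`.
  ⊆rest : ∀ {z} → z ∈ xs → z ∈ ps ++ qs
  ⊆rest z∈xs with ∈-resp-↭ (shift x ps qs) (⊆ys (there z∈xs))
  ... | here z≡x  = contradiction (sym z≡x) (All.lookup x∉xs z∈xs)
  ... | there z∈  = z∈

edgeLength-sym : ∀ v u w → edgeLength v u w ≡ edgeLength v w u
edgeLength-sym v u w rewrite ∣-∣-comm u w = refl

-- Edge lengths are symmetric, so reversing the arm `p` only permutes its lengths.
pathLengths-ʳ++ : ∀ v u p q →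
  pathLengths v (p ʳ++ (u ∷ q)) ↭ pathLengths v (u ∷ p) ++ pathLengths v (u ∷ q)
pathLengths-ʳ++ v u []      q = ↭-refl
pathLengths-ʳ++ v u (w ∷ p) q = ↭-trans (pathLengths-ʳ++ v w p (u ∷ q))
  (subst (λ e → pathLengths v (w ∷ p) ++ e ∷ pathLengths v (u ∷ q) ↭
                edgeLength v u w ∷ pathLengths v (w ∷ p) ++ pathLengths v (u ∷ q))
         (edgeLength-sym v u w) (shift _ (pathLengths v (w ∷ p)) _))

replicate-+ : ∀ {A : Set} m n (z : A) → replicate (m + n) z ≡ replicate m z ++ replicate n z
replicate-+ zero    n z = refl
replicate-+ (suc m) n z = cong (z ∷_) (replicate-+ m n z)

-- Congruence modulo `v`, edge lengths and multiplication of the vertices.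

module Mod (v : ℕ) .{{_ : NonZero v}} where

  infix 4 _≈_

  record _≈_ (i j : ℤ) : Set where
    constructor _,_
    field
      quotient : ℤ
      equality : i ≡ j ℤ.+ quotient ℤ.* + v

  ≈-sym : ∀ {i j} → i ≈ j → j ≈ i
  ≈-sym {i} {j} (k , refl) = ℤ.- k , eq j k (+ v)
    where
    eq : ∀ j k v → j ≡ (j ℤ.+ k ℤ.* v) ℤ.+ (ℤ.- k) ℤ.* v
    eq = ℤ.solve-∀

  ≈-trans : ∀ {i j k} → i ≈ j → j ≈ k → i ≈ k
  ≈-trans {k = k} (m , refl) (n , refl) = m ℤ.+ n , eq k m n (+ v)
    where
    eq : ∀ k m n v → (k ℤ.+ n ℤ.* v) ℤ.+ m ℤ.* v ≡ k ℤ.+ (m ℤ.+ n) ℤ.* v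
    eq = ℤ.solve-∀

  ≈-reflexive : ∀ {i j} → i ≡ j → i ≈ j
  ≈-reflexive {i} refl = + 0 , sym (ℤ.+-identityʳ i)

  ≈-+ : ∀ {i j k l} → i ≈ j → k ≈ l → i ℤ.+ k ≈ j ℤ.+ l
  ≈-+ {j = j} {l = l} (m , refl) (n , refl) = m ℤ.+ n , eq j l m n (+ v)
    where
    eq : ∀ j l m n v → (j ℤ.+ m ℤ.* v) ℤ.+ (l ℤ.+ n ℤ.* v) ≡ (j ℤ.+ l) ℤ.+ (m ℤ.+ n) ℤ.* v
    eq = ℤ.solve-∀

  ≈-+ˡ : ∀ i {j k} → j ≈ k → i ℤ.+ j ≈ i ℤ.+ k
  ≈-+ˡ i {k = k} (m , refl) = m , sym (ℤ.+-assoc i k (m ℤ.* + v))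

  ≈-*ˡ : ∀ c {i j} → i ≈ j → c ℤ.* i ≈ c ℤ.* j
  ≈-*ˡ c {j = j} (m , refl) = c ℤ.* m , eq c j m (+ v)
    where
    eq : ∀ c j m v → c ℤ.* (j ℤ.+ m ℤ.* v) ≡ c ℤ.* j ℤ.+ c ℤ.* m ℤ.* v
    eq = ℤ.solve-∀

  ≈-neg : ∀ {i j} → i ≈ j → ℤ.- i ≈ ℤ.- j
  ≈-neg {j = j} (m , refl) = ℤ.- m , eq j m (+ v)
    where
    eq : ∀ j m v → ℤ.- (j ℤ.+ m ℤ.* v) ≡ ℤ.- j ℤ.+ (ℤ.- m) ℤ.* v
    eq = ℤ.solve-∀

  %ℕ-≈ : ∀ i → + (i %ℕ v) ≈ i
  %ℕ-≈ i = ≈-sym (i /ℕ v , a≡a%ℕn+[a/ℕn]*n i v)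

  -- Congruence up to sign, because an edge length determines the difference of its ends only up to
  -- sign.
  Near : ℕ → ℤ → Set
  Near e i = i ≈ + e ⊎ i ≈ ℤ.- + e

  Near-neg : ∀ {e i} → Near e i → Near e (ℤ.- i)
  Near-neg (inj₁ i≈) = inj₂ (≈-neg i≈)
  Near-neg {e} (inj₂ i≈) = inj₁ (≈-trans (≈-neg i≈) (≈-reflexive (ℤ.neg-involutive (+ e))))

  Near-resp : ∀ {e i j} → j ≈ i → Near e i → Near e j
  Near-resp j≈i (inj₁ i≈) = inj₁ (≈-trans j≈i i≈)
  Near-resp j≈i (inj₂ i≈) = inj₂ (≈-trans j≈i i≈)

  -- Since `Q < v` and `P + e < 2 v`, reducing `P + e` subtracts `v` at most once.
  offset : ∀ {P Q e} → P < v → Q < v → + Q ≈ + P ℤ.+ + e → e < v → Q ≡ P + e ⊎ Q + v ≡ P + e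
  offset {P} {Q} {e} P<v Q<v (+ zero , eq) e<v =
    inj₁ (trans (ℤ.+-injective eq) (+-identityʳ _))
  offset {P} {Q} {e} P<v Q<v (+ suc k , eq) e<v = contradiction Q<v (≤⇒≯ v≤Q)
    where
    Q≡ : Q ≡ P + e + suc k * v
    Q≡ = ℤ.+-injective (trans eq (cong (λ m → + P ℤ.+ + e ℤ.+ m) (sym (ℤ.pos-* (suc k) v))))
    v≤Q : v ≤ Q
    v≤Q = ≤-trans (m≤m+n v (k * v)) (≤-trans (m≤n+m _ (P + e)) (≤-reflexive (sym Q≡)))
  offset {P} {Q} {e} P<v Q<v (-[1+ k ] , eq) e<v = go k Q+≡
    where
    cancel : ∀ i m v → i ℤ.+ (ℤ.- m) ℤ.* v ℤ.+ m ℤ.* v ≡ i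
    cancel = ℤ.solve-∀
    Q+≡ : Q + suc k * v ≡ P + e
    Q+≡ = ℤ.+-injective (trans (cong₂ ℤ._+_ eq (ℤ.pos-* (suc k) v))
      (cancel (+ P ℤ.+ + e) (+ suc k) (+ v)))
    go : ∀ k → Q + suc k * v ≡ P + e → Q ≡ P + e ⊎ Q + v ≡ P + e
    go zero eq = inj₂ (trans (cong (_+_ Q) (sym (+-identityʳ v))) eq)
    go (suc k) eq = contradiction (+-mono-< P<v e<v) (≤⇒≯ (≤-trans
      (≤-trans (+-monoʳ-≤ v (m≤m+n v (k * v))) (m≤n+m _ Q))
      (≤-reflexive eq)))

  residue-unique : ∀ {P Q} → P < v → Q < v → + Q ≈ + P → Q ≡ P
  residue-unique {P} {Q} P<v Q<v Q≈P
    with offset P<v Q<v (≈-trans Q≈P (≈-reflexive (sym (ℤ.+-identityʳ (+ P))))) (≤-<-trans z≤n P<v)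
  ... | inj₁ eq = trans eq (+-identityʳ P)
  ... | inj₂ eq = contradiction P<v (≤⇒≯ (≤-trans (m≤n+m v Q) (≤-reflexive (trans eq (+-identityʳ P)))))

  -- The ends differ by `e` or by `v - e`, and `e + e ≤ v` makes `e` the smaller of the two.
  edgeLength-offset : ∀ {P Q e} → P < v → Q < v → e + e ≤ v → e < v →
                      + Q ≈ + P ℤ.+ + e → edgeLength v P Q ≡ e
  edgeLength-offset {P} {Q} {e} P<v Q<v 2e≤v e<v Q≈ with offset P<v Q<v Q≈ e<v
  ... | inj₁ refl rewrite ∣m-m+n∣≡n P e = m≤n⇒m⊓n≡m (m+n≤o⇒m≤o∸n e 2e≤v)
  ... | inj₂ Q+v≡P+e = begin
    ∣ P - Q ∣ ⊓ (v ∸ ∣ P - Q ∣) ≡⟨ cong (λ d → d ⊓ (v ∸ d)) P-Q ⟩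
    (v ∸ e) ⊓ (v ∸ (v ∸ e))     ≡⟨ cong ((v ∸ e) ⊓_) (m∸[m∸n]≡n (<⇒≤ e<v)) ⟩
    (v ∸ e) ⊓ e                 ≡⟨ m≥n⇒m⊓n≡n (m+n≤o⇒m≤o∸n e 2e≤v) ⟩
    e                           ∎
    where
    open ≡-Reasoning
    P≡ : P ≡ Q + (v ∸ e)
    P≡ = +-cancelʳ-≡ e P (Q + (v ∸ e)) (trans (sym Q+v≡P+e)
      (trans (cong (_+_ Q) (sym (m∸n+n≡m (<⇒≤ e<v)))) (sym (+-assoc Q _ e))))
    P-Q : ∣ P - Q ∣ ≡ v ∸ e
    P-Q = trans (cong (λ p → ∣ p - Q ∣) P≡) (trans (∣-∣-comm (Q + (v ∸ e)) Q) (∣m-m+n∣≡n Q (v ∸ e)))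

  edgeLength-near : ∀ {P Q e} → P < v → Q < v → e + e ≤ v → e < v →
                    Near e (+ Q ℤ.- + P) → edgeLength v P Q ≡ e
  edgeLength-near {P} {Q} {e} P<v Q<v 2e≤v e<v (inj₁ d≈) =
    edgeLength-offset P<v Q<v 2e≤v e<v (≈-trans (≈-reflexive (eq (+ P) (+ Q))) (≈-+ˡ (+ P) d≈))
    where
    eq : ∀ p q → q ≡ p ℤ.+ (q ℤ.- p)
    eq = ℤ.solve-∀
  edgeLength-near {P} {Q} {e} P<v Q<v 2e≤v e<v (inj₂ d≈) = trans (edgeLength-sym v P Q)
    (edgeLength-offset Q<v P<v 2e≤v e<v
      (≈-trans (≈-reflexive (eq (+ P) (+ Q))) (≈-+ˡ (+ Q)
        (≈-trans (≈-neg d≈) (≈-reflexive (ℤ.neg-involutive (+ e)))))))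
    where
    eq : ∀ p q → p ≡ q ℤ.+ (ℤ.- (q ℤ.- p))
    eq = ℤ.solve-∀

  -- The multiplier is an integer because the reflected arm is multiplied by `- c`.
  scale : ℤ → ℕ → ℕ
  scale c n = (c ℤ.* + n) %ℕ v

  scale<v : ∀ c n → scale c n < v
  scale<v c n = n%ℕd<d (c ℤ.* + n) v

  scale-diff : ∀ c s t → + scale c t ℤ.- + scale c s ≈ c ℤ.* (+ t ℤ.- + s)
  scale-diff c s t = ≈-trans (≈-+ (%ℕ-≈ (c ℤ.* + t)) (≈-neg (%ℕ-≈ (c ℤ.* + s))))
                             (≈-reflexive (eq c (+ t) (+ s)))
    where
    eq : ∀ c t s → c ℤ.* t ℤ.+ (ℤ.- (c ℤ.* s)) ≡ c ℤ.* (t ℤ.- s)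
    eq = ℤ.solve-∀

  edgeLength-scale : ∀ {c d e s t} → e + e ≤ v → e < v → Near e (c ℤ.* + d) → Apart d s t →
                     edgeLength v (scale c s) (scale c t) ≡ e
  edgeLength-scale {c} {d} {e} {s} {t} 2e≤v e<v cd (inj₁ refl) =
    edgeLength-near (scale<v c s) (scale<v c t) 2e≤v e<v
      (Near-resp (≈-trans (scale-diff c s t) (≈-reflexive (cong (c ℤ.*_) (eq (+ s) (+ d))))) cd)
    where
    eq : ∀ s d → (s ℤ.+ d) ℤ.- s ≡ d
    eq = ℤ.solve-∀
  edgeLength-scale {c} {d} {e} {s} {t} 2e≤v e<v cd (inj₂ refl) =
    trans (edgeLength-sym v (scale c s) (scale c t))
      (edgeLength-scale {c} {d} {e} {t} {s} 2e≤v e<v cd (inj₁ refl))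

  pathLengths-scale : ∀ c {x e f u w p a b} → e + e ≤ v → e < v → f + f ≤ v → f < v →
    Near e (c ℤ.* + 1) → Near f (c ℤ.* + x) → Walk x u w p a b →
    pathLengths v (map (scale c) (u ∷ p)) ↭ replicate a e ++ replicate b f
  pathLengths-scale _ _ _ _ _ _ _ stop = ↭-refl
  pathLengths-scale c {x} {e} {f} 2e≤v e<v 2f≤v f<v c1 cx (unit {u} {w} d p)
    rewrite edgeLength-scale {c} {1} {e} {u} {w} 2e≤v e<v c1 d =
    prep e (pathLengths-scale c 2e≤v e<v 2f≤v f<v c1 cx p)
  pathLengths-scale c {x} {e} {f} 2e≤v e<v 2f≤v f<v c1 cx (jump {u} {w} {a = a} {b = b} d p)
    rewrite edgeLength-scale {c} {x} {f} {u} {w} 2f≤v f<v cx d =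
    ↭-trans (prep f (pathLengths-scale c 2e≤v e<v 2f≤v f<v c1 cx p))
      (↭-sym (shift f (replicate a e) (replicate b f)))

  -- Inverses modulo `v` and the joining of two tours.

  half⇒< : ∀ {e} → e + e ≤ v → e < v
  half⇒< {zero}  _    = >-nonZero⁻¹ v
  half⇒< {suc e} 2e≤v = ≤-trans (+-monoˡ-≤ (suc e) (s≤s (z≤n {e}))) 2e≤v

  ≈-complement : ∀ c {z} → z ≤ v → c ℤ.* + (v ∸ z) ≈ (ℤ.- c) ℤ.* + z
  ≈-complement c {z} z≤v = c , trans (eq c (+ z) (+ (v ∸ z)))
    (cong (λ w → (ℤ.- c) ℤ.* + z ℤ.+ c ℤ.* + w) (m+[n∸m]≡n z≤v))
    where
    eq : ∀ c z w → c ℤ.* w ≡ (ℤ.- c) ℤ.* z ℤ.+ c ℤ.* (z ℤ.+ w)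
    eq = ℤ.solve-∀

  ≈-cancel-inverse : ∀ c c⁻¹ n → c ℤ.* c⁻¹ ≈ + 1 → c ℤ.* + scale c⁻¹ n ≈ + n
  ≈-cancel-inverse c c⁻¹ n cc⁻¹≈1 = ≈-trans (≈-*ˡ c (%ℕ-≈ (c⁻¹ ℤ.* + n)))
    (≈-trans (≈-reflexive (eq c c⁻¹ (+ n)))
      (≈-trans (≈-*ˡ (+ n) cc⁻¹≈1) (≈-reflexive (ℤ.*-identityʳ (+ n)))))
    where
    eq : ∀ c d n → c ℤ.* (d ℤ.* n) ≡ n ℤ.* (c ℤ.* d)
    eq = ℤ.solve-∀

  -- Either the residue of `c⁻¹ g` or its complement in `v` is at most half of `v`, and the sign is
  -- free. The bound on `Y` limits the number of unit steps that steps of length `Y` call for.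
  small-preimage : ∀ c c⁻¹ g → c ℤ.* c⁻¹ ≈ + 1 → ∃ λ Y → Y + Y ≤ v × Near g (c ℤ.* + Y)
  small-preimage c c⁻¹ g cc⁻¹≈1 with scale c⁻¹ g | scale<v c⁻¹ g | ≈-cancel-inverse c c⁻¹ g cc⁻¹≈1
  ... | z | z<v | cz≈g with ≤-total (z + z) v
  ...   | inj₁ 2z≤v = z , 2z≤v , inj₁ cz≈g
  ...   | inj₂ v≤2z = v ∸ z ,
    ≤-trans (+-monoʳ-≤ (v ∸ z) v∸z≤z) (≤-reflexive (m∸n+n≡m (<⇒≤ z<v))) ,
    inj₂ (≈-trans (≈-complement c (<⇒≤ z<v))
      (≈-trans (≈-reflexive (sym (ℤ.neg-distribˡ-* c (+ z)))) (≈-neg cz≈g)))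
    where
    v∸z≤z : v ∸ z ≤ z
    v∸z≤z = m≤n+o⇒m∸n≤o v z v≤2z

  Near-* : ∀ d {i} → Near 1 i → Near d (+ d ℤ.* i)
  Near-* d (inj₁ i≈) = inj₁ (≈-trans (≈-*ˡ (+ d) i≈) (≈-reflexive (ℤ.*-identityʳ (+ d))))
  Near-* d (inj₂ i≈) = inj₂ (≈-trans (≈-*ˡ (+ d) i≈) (≈-reflexive (eq (+ d))))
    where
    eq : ∀ d → d ℤ.* (ℤ.- + 1) ≡ ℤ.- d
    eq = ℤ.solve-∀

  Near-1⇒inverse : ∀ c d → Near 1 (c ℤ.* d) → ∃ λ c⁻¹ → c ℤ.* c⁻¹ ≈ + 1
  Near-1⇒inverse c d (inj₁ cd≈) = d , cd≈
  Near-1⇒inverse c d (inj₂ cd≈) = ℤ.- d ,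
    ≈-trans (≈-reflexive (sym (ℤ.neg-distribʳ-* c d))) (≈-neg cd≈)

  -- `X` unit steps go to the arm with steps `X`, the other `ρ ≥ Y` to the arm with steps `Y`. The
  -- latter meets `c z` for `z ≤ ρ + γ`. Any other `z` has `v - z ≤ X + β`, and the former,
  -- multiplied by `- c`, meets `(- c) (v - z)`, which is `c z` modulo `v`. As `c` is invertible,
  -- these are all the residues.
  glue : ∀ c c⁻¹ {X Y e f g α β γ} .{{_ : NonZero X}} .{{_ : NonZero Y}} →
    c ℤ.* c⁻¹ ≈ + 1 → Near e (c ℤ.* + 1) → Near f (c ℤ.* + X) → Near g (c ℤ.* + Y) →
    e + e ≤ v → f + f ≤ v → g + g ≤ v → X + Y ≤ α → α + β + γ + 1 ≡ v →
    Realizable v (replicate α e ++ replicate β f ++ replicate γ g)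
  glue c c⁻¹ {X} {Y} {e} {f} {g} {α} {β} {γ} cc⁻¹≈1 c1 cX cY 2e≤v 2f≤v 2g≤v X+Y≤α size
    with ρ , refl ← m≤n⇒∃[o]m+o≡n (m+n≤o⇒m≤o X X+Y≤α)
    with _ , A ← initial-tour X X β ≤-refl
       | _ , B ← initial-tour Y ρ γ (+-cancelˡ-≤ X Y ρ X+Y≤α) =
    -- A list of length `v` that hits all `v` residues hits each exactly once.
    path , unique-⊆⇒↭ (upTo⁺ v) (λ n∈ → hits (∈-upTo⁻ n∈))
             (≤-reflexive (trans len (sym (length-upTo v)))) , lengths
    where
    P = map (scale (ℤ.- c)) (tail A)
    Q = map (scale c) (tail B)
    path = P ʳ++ (scale c 0 ∷ Q)

    scale-0 : scale (ℤ.- c) 0 ≡ scale c 0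
    scale-0 = cong (_%ℕ v) (trans (ℤ.*-zeroʳ (ℤ.- c)) (sym (ℤ.*-zeroʳ c)))

    len : length path ≡ v
    len = begin
      length path
        ≡⟨ length-ʳ++ P ⟩
      length P + suc (length Q)
        ≡⟨ cong₂ (λ a b → a + suc b) (length-map _ (tail A)) (length-map _ (tail B)) ⟩
      length (tail A) + suc (length (tail B))
        ≡⟨ cong₂ (λ a b → a + suc b) (walk-length (walk A)) (walk-length (walk B)) ⟩
      X + β + suc (ρ + γ)
        ≡⟨ eq X β ρ γ ⟩
      X + ρ + β + γ + 1
        ≡⟨ size ⟩
      v ∎
      where
      open ≡-Reasoning
      eq : ∀ X β ρ γ → X + β + suc (ρ + γ) ≡ X + ρ + β + γ + 1
      eq = solve-∀

    hits : ∀ {n} → n < v → n ∈ path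
    hits {n} n<v = by (≤-<-connex z (ρ + γ))
      where
      z = scale c⁻¹ n
      z≤v = <⇒≤ (scale<v c⁻¹ n)
      cz≈n = ≈-cancel-inverse c c⁻¹ n cc⁻¹≈1

      inB : n ≡ scale c z
      inB = residue-unique (scale<v c z) n<v (≈-sym (≈-trans (%ℕ-≈ (c ℤ.* + z)) cz≈n))

      inA : n ≡ scale (ℤ.- c) (v ∸ z)
      inA = residue-unique (scale<v (ℤ.- c) (v ∸ z)) n<v (≈-sym (≈-trans (%ℕ-≈ ((ℤ.- c) ℤ.* + (v ∸ z)))
        (≈-trans (≈-complement (ℤ.- c) z≤v)
          (≈-trans (≈-reflexive (cong (ℤ._* + z) (ℤ.neg-involutive c))) cz≈n))))

      beyond : ρ + γ < z → v ∸ z ≤ X + β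
      beyond ρ+γ<z = m≤n+o⇒m∸n≤o v z (≤-trans (≤-reflexive (trans (sym size) (eq X β ρ γ)))
                                               (+-monoˡ-≤ (X + β) ρ+γ<z))
        where
        eq : ∀ X β ρ γ → X + ρ + β + γ + 1 ≡ suc (ρ + γ) + (X + β)
        eq = solve-∀

      by : z ≤ ρ + γ ⊎ ρ + γ < z → n ∈ path
      by (inj₁ z≤) = reverseAcc⁺ (scale c 0 ∷ Q) P (inj₁
        (subst (_∈ map (scale c) (0 ∷ tail B)) (sym inB) (∈-map⁺ (scale c) (covers B z≤))))
      by (inj₂ z>) with subst (_∈ map (scale (ℤ.- c)) (0 ∷ tail A)) (sym inA)
                          (∈-map⁺ (scale (ℤ.- c)) (covers A (beyond z>)))
      -- The common start of both arms is listed once, with the second arm.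
      ... | here n≡   = reverseAcc⁺ (scale c 0 ∷ Q) P (inj₁ (here (trans n≡ scale-0)))
      ... | there n∈P = reverseAcc⁺ (scale c 0 ∷ Q) P (inj₂ n∈P)

    negated : ∀ {e d} → Near e (c ℤ.* + d) → Near e ((ℤ.- c) ℤ.* + d)
    negated {e} {d} cd = subst (Near e) (ℤ.neg-distribˡ-* c (+ d)) (Near-neg cd)

    lengths : pathLengths v path ↭ replicate (X + ρ) e ++ replicate β f ++ replicate γ g
    lengths = begin
      pathLengths v path
        ↭⟨ pathLengths-ʳ++ v (scale c 0) P Q ⟩
      pathLengths v (scale c 0 ∷ P) ++ pathLengths v (scale c 0 ∷ Q)
        ≡⟨ cong (λ h → pathLengths v (h ∷ P) ++ pathLengths v (scale c 0 ∷ Q)) scale-0 ⟨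
      pathLengths v (map (scale (ℤ.- c)) (0 ∷ tail A)) ++ pathLengths v (map (scale c) (0 ∷ tail B))
        ↭⟨ ++⁺ (pathLengths-scale (ℤ.- c) 2e≤v (half⇒< 2e≤v) 2f≤v (half⇒< 2f≤v)
                 (negated {e} {1} c1) (negated {f} {X} cX) (walk A))
               (pathLengths-scale c 2e≤v (half⇒< 2e≤v) 2g≤v (half⇒< 2g≤v) c1 cY (walk B)) ⟩
      (replicate X e ++ replicate β f) ++ replicate ρ e ++ replicate γ g
        ≡⟨ ++-assoc (replicate X e) _ _ ⟩
      replicate X e ++ replicate β f ++ replicate ρ e ++ replicate γ g
        ↭⟨ ++⁺ˡ (replicate X e) (shifts (replicate β f) (replicate ρ e)) ⟩
      replicate X e ++ replicate ρ e ++ replicate β f ++ replicate γ g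
        ≡⟨ ++-assoc (replicate X e) _ _ ⟨
      (replicate X e ++ replicate ρ e) ++ replicate β f ++ replicate γ g
        ≡⟨ cong (_++ replicate β f ++ replicate γ g) (replicate-+ X ρ e) ⟨
      replicate (X + ρ) e ++ replicate β f ++ replicate γ g ∎
      where open PermutationReasoning

-- Multiplicities and the choice of the unit.

tally : ∀ {a b c : ℕ} {L} → All (λ z → z ≡ a ⊎ z ≡ b ⊎ z ≡ c) L →
        Σ ℕ λ α → Σ ℕ λ β → Σ ℕ λ γ → L ↭ replicate α a ++ replicate β b ++ replicate γ c
tally All.[] = 0 , 0 , 0 , ↭-refl
tally {a} {b} {c} (z≡ All.∷ zs) with α , β , γ , L↭ ← tally zs with z≡
... | inj₁ refl        = suc α , β , γ , prep a L↭
... | inj₂ (inj₁ refl) = α , suc β , γ ,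
  ↭-trans (prep b L↭) (↭-sym (shift b (replicate α a) _))
... | inj₂ (inj₂ refl) = α , β , suc γ , ↭-trans (prep c L↭)
  (↭-trans (↭-sym (shift c (replicate α a) _)) (++⁺ˡ (replicate α a) (↭-sym (shift c (replicate β b) _))))

Realizable-resp-↭ : ∀ {v L M} → L ↭ M → Realizable v L → Realizable v M
Realizable-resp-↭ L↭M (p , p↭ , lengths) = p , p↭ , ↭-trans lengths L↭M

-- Twice the sum of the three strict bounds is set against `2 (v + 2)`. From above, `2 Y ≤ v` and
-- `x + y ≤ k` give `k (2 x² + 2 x + 2) + 2 k y + v`. From below, `k x y ≤ v + 1`,
-- `x y = y (x - 2) + 2 y` and the bound on `y` give at least 3 more.
few-of-each⇒⊥ : ∀ x y k Y v a b c → 2 < x → 2 * x * x + 2 * x + 1 < y * (x ∸ 2) → x + y ≤ k →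
  k * (x * y) ≤ v + 1 → Y + Y ≤ v → a + b + c + 1 ≡ v →
  a < x + y → b < k * y + Y → ¬ (c < k * x + k * (x * x))
few-of-each⇒⊥ (suc zero) _ _ _ _ _ _ _ (s≤s ())
few-of-each⇒⊥ x@(suc (suc x′)) y k Y v a b c _ y-large k-large kxy≤ 2Y≤v size a< b< c< =
  contradiction (+-cancelʳ-≤ R _ _ chain) (<⇒≱ (s≤s (m≤m+n (2 * k) 2)))
  where
  open ≤-Reasoning
  R = k * (2 * x * x + 2 * x) + 2 * (k * y) + v
  chain : suc (2 * k + 2) + R ≤ 2 * k + R
  chain = begin
    suc (2 * k + 2) + R
      ≡⟨ eq₁ x k (k * y) v ⟩
    k * (2 + (2 * x * x + 2 * x)) + 2 * (k * y) + v + 3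
      -- Strictness of the bound on `y` contributes part of the `2 k` that pays for `2 (x + y)`.
      ≤⟨ +-monoˡ-≤ 3 (+-monoˡ-≤ v (+-monoˡ-≤ (2 * (k * y)) (*-monoʳ-≤ k
           (subst (_≤ y * x′) (cong suc (+-comm _ 1)) y-large)))) ⟩
    k * (y * x′) + 2 * (k * y) + v + 3
      ≡⟨ eq₂ x′ y k v ⟩
    k * (x * y) + (v + 3)
      ≤⟨ +-monoˡ-≤ (v + 3) kxy≤ ⟩
    v + 1 + (v + 3)
      ≡⟨ cong (λ v → v + 1 + (v + 3)) (sym size) ⟩
    a + b + c + 1 + 1 + (a + b + c + 1 + 3)
      ≡⟨ eq₃ a b c ⟩
    2 * (suc a + suc b + suc c)
      ≤⟨ *-monoʳ-≤ 2 (+-mono-≤ (+-mono-≤ a< b<) c<) ⟩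
    2 * (x + y + (k * y + Y) + (k * x + k * (x * x)))
      ≤⟨ *-monoʳ-≤ 2 (+-monoˡ-≤ (k * x + k * (x * x)) (+-monoˡ-≤ (k * y + Y) k-large)) ⟩
    2 * (k + (k * y + Y) + (k * x + k * (x * x)))
      ≡⟨ eq₄ x y k Y ⟩
    2 * k + (k * (2 * x * x + 2 * x) + 2 * (k * y) + (Y + Y))
      ≤⟨ +-monoʳ-≤ (2 * k) (+-monoʳ-≤ (k * (2 * x * x + 2 * x) + 2 * (k * y)) 2Y≤v) ⟩
    2 * k + R ∎
    where
    eq₁ : ∀ x k z v → suc (2 * k + 2) + (k * (2 * x * x + 2 * x) + 2 * z + v) ≡
          k * (2 + (2 * x * x + 2 * x)) + 2 * z + v + 3
    eq₁ = solve-∀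
    eq₂ : ∀ x y k v → k * (y * x) + 2 * (k * y) + v + 3 ≡ k * (suc (suc x) * y) + (v + 3)
    eq₂ = solve-∀
    eq₃ : ∀ a b c → a + b + c + 1 + 1 + (a + b + c + 1 + 3) ≡ 2 * (suc a + suc b + suc c)
    eq₃ = solve-∀
    eq₄ : ∀ x y k Y → 2 * (k + (k * y + Y) + (k * x + k * (x * x))) ≡
          2 * k + (k * (2 * x * x + 2 * x) + 2 * (k * y) + (Y + Y))
    eq₄ = solve-∀

-- Both residue classes of `v` are treated at once, through `k x y ≡ ±1` modulo `v`.
realize : ∀ x y k v a b c .{{_ : NonZero v}} → 2 < x → 2 * x * x + 2 * x + 1 < y * (x ∸ 2) →
  x + y ≤ k → (x + y) * (x * y) ≤ v → k * (x * y) ≤ v + 1 → Mod.Near v 1 (+ (k * (x * y))) →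
  a + b + c + 1 ≡ v → Realizable v (replicate a 1 ++ replicate b x ++ replicate c y)
realize x y@zero k v a b c _ () _ _ _ _ _
realize x@(suc _) y@(suc _) k@zero v a b c _ _ () _ _ _ _
realize x@(suc _) y@(suc _) k@(suc _) v a b c 2<x y-large k-large v-large kxy≤ kxy≈±1 size =
  by (≤-<-connex (x + y) a) (≤-<-connex (k * x + k * (x * x)) c)
  where
  open Mod v

  small : ∀ d → d ≤ x + y → d + d ≤ v
  small d d≤ = begin
    d + d             ≡⟨ cong (_+_ d) (+-identityʳ d) ⟨
    2 * d             ≡⟨ *-comm 2 d ⟩
    d * 2             ≤⟨ *-mono-≤ d≤ (≤-trans (<⇒≤ 2<x) (m≤m*n x y)) ⟩
    (x + y) * (x * y) ≤⟨ v-large ⟩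
    v                 ∎
    where open ≤-Reasoning

  2≤v : 1 + 1 ≤ v
  2≤v = small 1 (s≤s z≤n)
  2x≤v = small x (m≤m+n x y)
  2y≤v = small y (m≤n+m y x)

  near-pos : ∀ {d} c n → c * n ≡ d → Near d (+ c ℤ.* + n)
  near-pos c n refl = inj₁ (≈-reflexive (sym (ℤ.pos-* c n)))

  y-kx : Near 1 (+ y ℤ.* + (k * x))
  y-kx = subst (Near 1) (trans (cong +_ (eq x y k)) (ℤ.pos-* y (k * x))) kxy≈±1
    where
    eq : ∀ x y k → k * (x * y) ≡ y * (k * x)
    eq = solve-∀

  y-kx² : Near x (+ y ℤ.* + (k * (x * x)))
  y-kx² = subst (Near x) (trans (sym (ℤ.pos-* x _)) (trans (cong +_ (eq x y k)) (ℤ.pos-* y _)))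
    (Near-* x kxy≈±1)
    where
    eq : ∀ x y k → x * (k * (x * y)) ≡ y * (k * (x * x))
    eq = solve-∀

  x-ky : Near 1 (+ x ℤ.* + (k * y))
  x-ky = subst (Near 1) (trans (cong +_ (eq x y k)) (ℤ.pos-* x (k * y))) kxy≈±1
    where
    eq : ∀ x y k → k * (x * y) ≡ x * (k * y)
    eq = solve-∀

  by : x + y ≤ a ⊎ a < x + y → k * x + k * (x * x) ≤ c ⊎ c < k * x + k * (x * x) →
       Realizable v (replicate a 1 ++ replicate b x ++ replicate c y)
  by (inj₁ a-large) _ = glue (+ 1) (+ 1) {x} {y} (≈-reflexive refl)
    (near-pos 1 1 refl) (near-pos 1 x (*-identityˡ x)) (near-pos 1 y (*-identityˡ y))
    2≤v 2x≤v 2y≤v a-large size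
  -- Multiplication by `y` sends the steps 1, `k x`, `k x²` to the lengths `y`, 1, `x`, so `c`
  -- counts the unit steps.
  by (inj₂ _) (inj₁ c-large) with y⁻¹ , isInverse ← Near-1⇒inverse (+ y) (+ (k * x)) y-kx =
    Realizable-resp-↭ (↭-trans (++-comm C (A ++ B)) (↭-reflexive (++-assoc A B C)))
      (glue (+ y) y⁻¹ {k * x} {k * (x * x)} {α = c} {a} {b} isInverse
        (near-pos y 1 (*-identityʳ y)) y-kx y-kx² 2y≤v 2≤v 2x≤v c-large (trans (eq a b c) size))
    where
    A = replicate a 1
    B = replicate b x
    C = replicate c y
    eq : ∀ a b c → c + a + b + 1 ≡ a + b + c + 1
    eq = solve-∀
  -- Multiplication by `x` sends 1, `k y`, `Y` to the lengths `x`, 1, `y`, so `b` counts the unit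
  -- steps.
  by (inj₂ a-small) (inj₂ c-small)
    with x⁻¹ , isInverse ← Near-1⇒inverse (+ x) (+ (k * y)) x-ky
    with small-preimage (+ x) x⁻¹ y isInverse
  -- With `Y = 0`, the length `y > 0` would be congruent to 0 up to sign, and so equal to the
  -- distance from 0 to itself.
  ... | zero , _ , x-0 = contradiction
    (edgeLength-near {0} {0} {y} 0<v 0<v 2y≤v (half⇒< 2y≤v)
      (subst (Near y) (ℤ.*-zeroʳ (+ x)) x-0)) λ ()
    where
    0<v = ≤-trans (s≤s z≤n) 2≤v
  ... | Y@(suc _) , 2Y≤v , x-Y with ≤-<-connex (k * y + Y) b
  ...   | inj₂ b-small = contradiction c-small
    (few-of-each⇒⊥ x y k Y v a b c 2<x y-large k-large kxy≤ 2Y≤v size a-small b-small)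
  ...   | inj₁ b-large = Realizable-resp-↭ (shifts (replicate b x) (replicate a 1))
    (glue (+ x) x⁻¹ {k * y} {Y} {α = b} {a} {c} isInverse
      (near-pos x 1 (*-identityʳ x)) x-ky x-Y 2x≤v 2≤v 2y≤v b-large (trans (eq a b c) size))
    where
    eq : ∀ a b c → b + a + c + 1 ≡ a + b + c + 1
    eq = solve-∀

theorem5p4 : (x y : ℕ) → 2 < x → 2 * x * x + 2 * x + 1 < y * (x ∸ 2) →
    Σ ℕ λ V → (v : ℕ) → V ≤ v → PlusMinusOneMod v (x * y) →
    (L : List ℕ) → length L + 1 ≡ v → HasSupport3 L 1 x y → Realizable v L
theorem5p4 x zero _ ()
-- This threshold yields `x + y ≤ k` on cancelling `x y`; its `+ 1` cancels against that of
-- `v = k x y + 1`.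
theorem5p4 x@(suc _) y@(suc _) 2<x y-large = (x + y) * (x * y) + 1 , realizable
  where
  realizable : (v : ℕ) → (x + y) * (x * y) + 1 ≤ v → PlusMinusOneMod v (x * y) →
               (L : List ℕ) → length L + 1 ≡ v → HasSupport3 L 1 x y → Realizable v L
  realizable v V≤v v≡±1 L size (L⊆ , _) with a , b , c , L↭ ← tally L⊆ =
    Realizable-resp-↭ (↭-sym L↭) (by v≡±1)
    where
    instance
      v≢0 : NonZero v
      v≢0 = >-nonZero (≤-trans (m≤n+m 1 ((x + y) * (x * y))) V≤v)

    v-large : (x + y) * (x * y) ≤ v
    v-large = m+n≤o⇒m≤o _ V≤v

    counts : a + b + c + 1 ≡ v
    counts = begin
      a + b + c + 1
        ≡⟨ cong (_+ 1) (+-assoc a b c) ⟩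
      a + (b + c) + 1
        ≡⟨ cong (_+ 1) (cong₂ _+_ (length-replicate a)
           (cong₂ _+_ (length-replicate b) (length-replicate c))) ⟨
      length (replicate a 1) + (length (replicate b x) + length (replicate c y)) + 1
        ≡⟨ cong (λ l → length (replicate a 1) + l + 1) (length-++ (replicate b x)) ⟨
      length (replicate a 1) + length (replicate b x ++ replicate c y) + 1
        ≡⟨ cong (_+ 1) (length-++ (replicate a 1)) ⟨
      length (replicate a 1 ++ replicate b x ++ replicate c y) + 1
        ≡⟨ cong (_+ 1) (↭-length L↭) ⟨
      length L + 1
        ≡⟨ size ⟩
      v ∎
      where open ≡-Reasoning

    by : PlusMinusOneMod v (x * y) → Realizable v (replicate a 1 ++ replicate b x ++ replicate c y)
    by (inj₁ (k , v≡)) = realize x y k v a b c 2<x y-large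
      (*-cancelʳ-≤ (x + y) k (x * y) (+-cancelʳ-≤ 1 _ _ (≤-trans V≤v (≤-reflexive v≡))))
      v-large (≤-trans (m≤m+n _ 1) (≤-trans (≤-reflexive (sym v≡)) (m≤m+n v 1)))
      (inj₂ (Mod._,_ (+ 1) eq)) counts
      where
      eq : + (k * (x * y)) ≡ ℤ.- + 1 ℤ.+ + 1 ℤ.* + v
      eq rewrite v≡ = ring (+ (k * (x * y)))
        where
        ring : ∀ w → w ≡ ℤ.- + 1 ℤ.+ + 1 ℤ.* (w ℤ.+ + 1)
        ring = ℤ.solve-∀
    by (inj₂ (k , v+1≡)) = realize x y k v a b c 2<x y-large
      (*-cancelʳ-≤ (x + y) k (x * y) (≤-trans v-large (≤-trans (m≤m+n v 1) (≤-reflexive v+1≡))))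
      v-large (≤-reflexive (sym v+1≡))
      (inj₁ (Mod._,_ (+ 1) eq)) counts
      where
      eq : + (k * (x * y)) ≡ + 1 ℤ.+ + 1 ℤ.* + v
      eq rewrite sym v+1≡ = ring (+ v)
        where
        ring : ∀ v → v ℤ.+ + 1 ≡ + 1 ℤ.+ + 1 ℤ.* v
        ring = ℤ.solve-∀
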